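{- The diversity measures Max-Sum Diversity $d_{\mathrm{sum}}$, Max-Min Diversity $d_{\mathrm{min}}$, and Max-Coverage Diversity $d_{\mathrm{cov}}$, defined for $r$-tuples of subsets of a universe $U$ by $$d_{\mathrm{sum}}(S_1,\ldots,S_r)=\sum_{1\le i<j\le r}|S_i\triangle S_j|,\quad d_{\mathrm{min}}(S_1,\ldots,S_r)=\min_{1\le i<j\le r}|S_i\triangle S_j|,\quad d_{\mathrm{cov}}(S_1,\ldots,S_r)=\Bigl|\bigcup_{i\in[r]}S_i\Bigr|,$$ are consistently diverse and polynomial-time computable.
   Context: Notation: $[r]=\{1,\ldots,r\}$; $\uplus$ denotes disjoint union; $S\triangle T=(S\setminus T)\cup(T\setminus S)$ is the symmetric difference. Diversity function: a map $\mathbb{D}:(2^{U})^r\to\mathbb{Z}_{\ge 0}$. It is polynomial-time computable if, given any $r$ sets $S_1,\ldots,S_r\subseteq U$, the value $\mathbb{D}(S_1,\ldots,S_r)$ can be computed in time polynomial in $|U|$. Relation $\le_{\mathcal D}$: for two $r$-tuples $\mathbb{T}_1=(A_1,\ldots,A_r)$ and $\mathbb{T}_2=(J_1,\ldots,J_r)$ of sets, write $\mathbb{T}_1\le_{\mathcal D}\mathbb{T}_2$ if there exist decompositions $A_i=B_i\uplus C_i$ and $J_i=K_i\uplus L_i$ for each $i\in[r]$ such that: (1) for every $i\in[r]$, $K_i\subseteq B_i$ and $|A_i|=|J_i|$; (2) for all distinct $i,j\in[r]$, $L_i\cap L_j=\emptyset$; (3) for every $i\in[r]$, $L_i\cap B_j=\emptyset$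 for all $j\in[r]$. Consistently diverse: $\mathbb{D}$ is consistently diverse if for any two $r$-tuples $\mathbb{T}_1,\mathbb{T}_2$ of subsets of a common universe $U$, whenever $\mathbb{T}_1\le_{\mathcal D}\mathbb{T}_2$ we have $\mathbb{D}(\mathbb{T}_1)\le\mathbb{D}(\mathbb{T}_2)$. -}

module Defs where

open import Data.Bool using (Bool; true; false; if_then_else_)
open import Data.Fin using (Fin)
open import Data.Fin.Properties using (_<?_)
open import Data.Fin.Subset using (Subset; _∪_; _∩_; _─_; _⊆_; ⋃; ∣_∣; Empty)
open import Data.List using
  (List; []; _∷_; allFin; cartesianProduct; concatMap; filter; foldr; map)
open import Data.Nat using (ℕ; zero; suc; _+_; _*_; _∸_; _^_; _⊓_; _≤_; _≡ᵇ_)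
open import Data.Product using (∃-syntax; _×_; _,_)
open import Data.Nat.ListAction using (sum)
import Data.Vec as Vec
open import Data.Vec.Functional using (Vector)
open import Relation.Binary.PropositionalEquality using (_≡_; _≢_)

private
  variable
    n r : ℕ

-- A finite universe U with ∣U∣ = n is taken to be Fin n.  A diversity function
-- on r-tuples is given for every universe at once.

Diversity : ℕ → Set
Diversity r = (n : ℕ) → Vector (Subset n) r → ℕ

infixl 6 _△_

_△_ : Subset n → Subset n → Subset n
S △ T = (S ─ T) ∪ (T ─ S)

pairs : (r : ℕ) → List (Fin r × Fin r)
pairs r = filter (λ (i , j) → i <? j) (cartesianProduct (allFin r) (allFin r))

distances : Vector (Subset n) r → List ℕ
distances {r = r} S = map (λ (i , j) → ∣ S i △ S j ∣) (pairs r)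

-- The minimum of no numbers is 0 by convention; for d-min this is used only
-- when r < 2, where there are no pairs i < j.

minimum : List ℕ → ℕ
minimum []       = 0
minimum (x ∷ xs) = foldr _⊓_ x xs

d-sum : (r : ℕ) → Diversity r
d-sum r n S = sum (distances S)

d-min : (r : ℕ) → Diversity r
d-min r n S = minimum (distances S)

d-cov : (r : ℕ) → Diversity r
d-cov r n S = ∣ ⋃ (map S (allFin r)) ∣

Disjoint : Subset n → Subset n → Set
Disjoint S T = Empty (S ∩ T)

infix 4 _≡_⊎_ _≤D_

record _≡_⊎_ (A B C : Subset n) : Set where
  field
    union    : A ≡ B ∪ C
    disjoint : Disjoint B C

record _≤D_ (A J : Vector (Subset n) r) : Set where
  field
    B C K L : Vector (Subset n) r
    A≡B⊎C   : ∀ i → A i ≡ B i ⊎ C i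
    J≡K⊎L   : ∀ i → J i ≡ K i ⊎ L i
    K⊆B     : ∀ i → K i ⊆ B i
    ∣A∣≡∣J∣ : ∀ i → ∣ A i ∣ ≡ ∣ J i ∣
    L∩L     : ∀ i j → i ≢ j → Disjoint (L i) (L j)
    L∩B     : ∀ i j → Disjoint (L i) (B j)

ConsistentlyDiverse : Diversity r → Set
ConsistentlyDiverse {r} 𝔻 =
  ∀ {n} (T₁ T₂ : Vector (Subset n) r) → T₁ ≤D T₂ → 𝔻 n T₁ ≤ 𝔻 n T₂

-- The model of computation is a random access machine with unit costs, with
-- structured programs in place of jumps.  Registers and memory cells hold
-- natural numbers and memory is addressed through registers.  There is no
-- multiplication: t steps lengthen the numbers involved by at most O(t) bits,
-- so polynomial time here agrees with polynomial time on Turing machines.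

Reg : Set
Reg = ℕ

data Instr : Set where
  const : (x : Reg) (c : ℕ) → Instr      -- x := c
  add   : (x y z : Reg) → Instr          -- x := y + z
  sub   : (x y z : Reg) → Instr          -- x := y ∸ z
  load  : (x y : Reg) → Instr            -- x := memory[ y ]
  store : (x y : Reg) → Instr            -- memory[ x ] := y

infixr 5 _⨾_

data Program : Set where
  skip  : Program
  instr : Instr → Program
  _⨾_   : Program → Program → Program
  ifnz  : Reg → Program → Program → Program
  while : Reg → Program → Program

record State : Set where
  constructor ⟪_,_⟫
  field
    reg : Reg → ℕ
    mem : ℕ → ℕ

open State public

_[_≔_] : (ℕ → ℕ) → ℕ → ℕ → (ℕ → ℕ)
(f [ a ≔ v ]) b = if a ≡ᵇ b then v else f b

exec : Instr → State → State
exec (const x c) ⟪ R , M ⟫ = ⟪ R [ x ≔ c ] , M ⟫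
exec (add x y z) ⟪ R , M ⟫ = ⟪ R [ x ≔ R y + R z ] , M ⟫
exec (sub x y z) ⟪ R , M ⟫ = ⟪ R [ x ≔ R y ∸ R z ] , M ⟫
exec (load x y)  ⟪ R , M ⟫ = ⟪ R [ x ≔ M (R y) ] , M ⟫
exec (store x y) ⟪ R , M ⟫ = ⟪ R , M [ R x ≔ R y ] ⟫

-- s ⊢ P ⇓ s′ in-time t : started in s, P halts in s′ after exactly t steps,
-- where each instruction, each skip and each test of a condition is one step.

infix 4 _⊢_⇓_in-time_

data _⊢_⇓_in-time_ (s : State) : Program → State → ℕ → Set where
  skip       : s ⊢ skip ⇓ s in-time 1
  instr      : ∀ I → s ⊢ instr I ⇓ exec I s in-time 1
  seq        : ∀ {P Q s′ s″ t u} →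
               s ⊢ P ⇓ s′ in-time t → s′ ⊢ Q ⇓ s″ in-time u →
               s ⊢ P ⨾ Q ⇓ s″ in-time (t + u)
  if-nonzero : ∀ {x P Q s′ t} → reg s x ≢ 0 →
               s ⊢ P ⇓ s′ in-time t →
               s ⊢ ifnz x P Q ⇓ s′ in-time suc t
  if-zero    : ∀ {x P Q s′ t} → reg s x ≡ 0 →
               s ⊢ Q ⇓ s′ in-time t →
               s ⊢ ifnz x P Q ⇓ s′ in-time suc t
  while-stop : ∀ {x P} → reg s x ≡ 0 →
               s ⊢ while x P ⇓ s in-time 1
  while-step : ∀ {x P s′ s″ t u} → reg s x ≢ 0 →
               s ⊢ P ⇓ s′ in-time t → s′ ⊢ while x P ⇓ s″ in-time u →
               s ⊢ while x P ⇓ s″ in-time suc (t + u)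

-- The input occupies memory from address 0 on; all else is initially 0.
-- The output is read off register 0.

at : List ℕ → ℕ → ℕ
at []       _       = 0
at (x ∷ _)  zero    = x
at (_ ∷ xs) (suc a) = at xs a

initial : List ℕ → State
initial input = ⟪ (λ _ → 0) , at input ⟫

_computes_from_within_ : Program → ℕ → List ℕ → ℕ → Set
P computes output from input within bound =
  ∃[ s ] ∃[ t ] (initial input ⊢ P ⇓ s in-time t) × reg s 0 ≡ output × t ≤ bound

-- A tuple is presented to the machine as n = ∣U∣ followed by the
-- characteristic vectors of S₁, …, Sᵣ, one bit per cell.

bit : Bool → ℕ
bit false = 0
bit true  = 1

encode : Vector (Subset n) r → List ℕ
encode {n} {r} S = n ∷ concatMap (λ i → map bit (Vec.toList (S i))) (allFin r)

-- r is fixed: the program and the polynomial may depend on r, but not on the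
-- universe or on the sets.

PolynomialTimeComputable : Diversity r → Set
PolynomialTimeComputable {r} 𝔻 =
  ∃[ P ] ∃[ c ] ∃[ k ] ∀ n (S : Vector (Subset n) r) →
    P computes 𝔻 n S from encode S within (c * n ^ k + c)

{-# OPTIONS --safe #-}
module Submission where

-- Each J_i ∩ J_j collapses to K_i ∩ K_j ⊆ A_i ∩ A_j, while ∣S △ T∣ = ∣S∣ + ∣T∣ − 2∣S ∩ T∣, so
-- no pairwise distance decreases.  For the coverage, A_i = K_i ⊎ (A_i ∖ K_i) and J_i = K_i ⊎ L_i
-- with ∣A_i ∖ K_i∣ = ∣L_i∣, and the L_i are disjoint from each other and from every K_j, so
-- ∣⋃ A∣ ≤ ∣⋃ K∣ + Σ ∣L_i∣ = ∣⋃ J∣.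
--
-- For the running times, the three measures are written as expressions built from memory reads,
-- sums, truncated differences and sums over the universe.  Every such expression compiles to a
-- program whose running time depends on n alone and is bounded by a polynomial in n.

open import Defs
open import Data.Fin using (Fin; zero; suc; toℕ; _≟_)
open import Data.Fin.Subset using
  (Subset; inside; outside; _∈_; _∉_; _∪_; _∩_; _─_; _⊆_; ⊥; ⋃; ∣_∣)
open import Data.Fin.Subset.Properties using
  ( Empty-unique; ∉⊥; ∣⊥∣≡0; p⊆q⇒∣p∣≤∣q∣; x∈p∪q⁻; x∈p∪q⁺; x∈p∩q⁻; x∈p∩q⁺; p⊆p∪q
  ; ⊆-antisym; p─q⊆p; _∈?_; x∈p∧x∉q⇒x∈p─q)
open import Data.List using
  (List; []; _∷_; _++_; allFin; applyDownFrom; concatMap; foldr; map; tabulate)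
open import Data.List.Properties using (map-cong; map-∘; map-tabulate; tabulate-cong)
open import Data.Nat using
  (ℕ; zero; suc; _+_; _*_; _∸_; _^_; _⊓_; _⊔_; _≤_; _<_; z≤n; s≤s)
open import Data.Nat.ListAction using (sum)
open import Data.Nat.Properties hiding (_≟_)
open import Data.Nat.Tactic.RingSolver using (solve-∀)
open import Data.Product using (∃-syntax; _×_; _,_; proj₁; proj₂)
open import Data.Sum using (inj₁; inj₂; [_,_]′)
open import Data.Vec using ([]; _∷_; here; there; toList)
open import Data.Vec.Functional using (Vector)
open import Function using (_∘_)
open import Relation.Binary.PropositionalEquality using
  (_≡_; _≢_; refl; sym; trans; cong; cong₂; subst; module ≡-Reasoning)
open import Relation.Nullary using (yes; no; contradiction)

private
  variable
    n r : ℕ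

-- Cardinalities of unions, intersections and symmetric differences

∣p∪q∣+∣p∩q∣≡∣p∣+∣q∣ : (p q : Subset n) → ∣ p ∪ q ∣ + ∣ p ∩ q ∣ ≡ ∣ p ∣ + ∣ q ∣
∣p∪q∣+∣p∩q∣≡∣p∣+∣q∣ []            []            = refl
∣p∪q∣+∣p∩q∣≡∣p∣+∣q∣ (outside ∷ p) (outside ∷ q) = ∣p∪q∣+∣p∩q∣≡∣p∣+∣q∣ p q
∣p∪q∣+∣p∩q∣≡∣p∣+∣q∣ (outside ∷ p) (inside  ∷ q) =
  trans (cong suc (∣p∪q∣+∣p∩q∣≡∣p∣+∣q∣ p q)) (sym (+-suc ∣ p ∣ ∣ q ∣))
∣p∪q∣+∣p∩q∣≡∣p∣+∣q∣ (inside  ∷ p) (outside ∷ q) = cong suc (∣p∪q∣+∣p∩q∣≡∣p∣+∣q∣ p q)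
∣p∪q∣+∣p∩q∣≡∣p∣+∣q∣ (inside  ∷ p) (inside  ∷ q) = cong suc
  (trans (+-suc ∣ p ∪ q ∣ ∣ p ∩ q ∣)
    (trans (cong suc (∣p∪q∣+∣p∩q∣≡∣p∣+∣q∣ p q)) (sym (+-suc ∣ p ∣ ∣ q ∣))))

-- An element of both sets counts twice on the right and not at all in the symmetric difference. For
-- fixed sizes, distances therefore grow as intersections shrink.
∣p△q∣+2∣p∩q∣≡∣p∣+∣q∣ : (p q : Subset n) →
  ∣ p △ q ∣ + (∣ p ∩ q ∣ + ∣ p ∩ q ∣) ≡ ∣ p ∣ + ∣ q ∣
∣p△q∣+2∣p∩q∣≡∣p∣+∣q∣ []            []            = refl
∣p△q∣+2∣p∩q∣≡∣p∣+∣q∣ (outside ∷ p) (outside ∷ q) = ∣p△q∣+2∣p∩q∣≡∣p∣+∣q∣ p q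
∣p△q∣+2∣p∩q∣≡∣p∣+∣q∣ (outside ∷ p) (inside  ∷ q) =
  trans (cong suc (∣p△q∣+2∣p∩q∣≡∣p∣+∣q∣ p q)) (sym (+-suc ∣ p ∣ ∣ q ∣))
∣p△q∣+2∣p∩q∣≡∣p∣+∣q∣ (inside  ∷ p) (outside ∷ q) = cong suc (∣p△q∣+2∣p∩q∣≡∣p∣+∣q∣ p q)
∣p△q∣+2∣p∩q∣≡∣p∣+∣q∣ (inside  ∷ p) (inside  ∷ q) =
  trans (shift ∣ p △ q ∣ ∣ p ∩ q ∣)
    (trans (cong (2 +_) (∣p△q∣+2∣p∩q∣≡∣p∣+∣q∣ p q)) (cong suc (sym (+-suc ∣ p ∣ ∣ q ∣))))
  where
  shift : ∀ a b → a + (suc b + suc b) ≡ suc (suc (a + (b + b)))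
  shift = solve-∀

∣p∪q∣≤∣p∣+∣q∣ : (p q : Subset n) → ∣ p ∪ q ∣ ≤ ∣ p ∣ + ∣ q ∣
∣p∪q∣≤∣p∣+∣q∣ p q =
  ≤-trans (m≤m+n ∣ p ∪ q ∣ ∣ p ∩ q ∣) (≤-reflexive (∣p∪q∣+∣p∩q∣≡∣p∣+∣q∣ p q))

Disjoint⇒∣p∪q∣≡∣p∣+∣q∣ : (p q : Subset n) → Disjoint p q → ∣ p ∪ q ∣ ≡ ∣ p ∣ + ∣ q ∣
Disjoint⇒∣p∪q∣≡∣p∣+∣q∣ {n} p q p∩q≡∅ = begin
  ∣ p ∪ q ∣               ≡⟨ +-identityʳ _ ⟨
  ∣ p ∪ q ∣ + 0           ≡⟨ cong (∣ p ∪ q ∣ +_) (∣⊥∣≡0 n) ⟨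
  ∣ p ∪ q ∣ + ∣ ⊥ {n} ∣   ≡⟨ cong (λ s → ∣ p ∪ q ∣ + ∣ s ∣) (Empty-unique p∩q≡∅) ⟨
  ∣ p ∪ q ∣ + ∣ p ∩ q ∣   ≡⟨ ∣p∪q∣+∣p∩q∣≡∣p∣+∣q∣ p q ⟩
  ∣ p ∣ + ∣ q ∣           ∎
  where open ≡-Reasoning

x∈p─q⇒x∉q : ∀ (p q : Subset n) {x} → x ∈ p ─ q → x ∉ q
x∈p─q⇒x∉q (_ ∷ p) (inside ∷ q)  () here
x∈p─q⇒x∉q (_ ∷ p) (_ ∷ q) (there x∈p─q) (there x∈q) = x∈p─q⇒x∉q p q x∈p─q x∈q

q⊆p⇒p≡q∪[p─q] : (p q : Subset n) → q ⊆ p → p ≡ q ∪ (p ─ q)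
q⊆p⇒p≡q∪[p─q] p q q⊆p = ⊆-antisym p⊆ (λ x∈ → [ q⊆p , p─q⊆p p q ]′ (x∈p∪q⁻ q (p ─ q) x∈))
  where
  p⊆ : p ⊆ q ∪ (p ─ q)
  p⊆ {x} x∈p with x ∈? q
  ... | yes x∈q = x∈p∪q⁺ (inj₁ x∈q)
  ... | no  x∉q = x∈p∪q⁺ (inj₂ (x∈p∧x∉q⇒x∈p─q x∈p x∉q))

-- Unions of finite families

x∈⋃⁻ : ∀ (S : Vector (Subset n) r) {x} → x ∈ ⋃ (tabulate S) → ∃[ i ] x ∈ S i
x∈⋃⁻ {r = zero}  S x∈ = contradiction x∈ ∉⊥
x∈⋃⁻ {r = suc r} S x∈ with x∈p∪q⁻ (S zero) _ x∈
... | inj₁ x∈S₀ = zero , x∈S₀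
... | inj₂ x∈⋃  with x∈⋃⁻ (S ∘ suc) x∈⋃
...   | i , x∈Sᵢ = suc i , x∈Sᵢ

x∈⋃⁺ : ∀ (S : Vector (Subset n) r) i {x} → x ∈ S i → x ∈ ⋃ (tabulate S)
x∈⋃⁺ S zero    x∈ = x∈p∪q⁺ (inj₁ x∈)
x∈⋃⁺ S (suc i) x∈ = x∈p∪q⁺ {p = S zero} (inj₂ (x∈⋃⁺ (S ∘ suc) i x∈))

⋃-∪ : (A S T : Vector (Subset n) r) → (∀ i → A i ≡ S i ∪ T i) →
  ⋃ (tabulate A) ≡ ⋃ (tabulate S) ∪ ⋃ (tabulate T)
⋃-∪ A S T A≡S∪T = ⊆-antisym to from
  where
  to : ⋃ (tabulate A) ⊆ ⋃ (tabulate S) ∪ ⋃ (tabulate T)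
  to x∈ with x∈⋃⁻ A x∈
  ... | i , x∈Aᵢ with x∈p∪q⁻ (S i) (T i) (subst (_ ∈_) (A≡S∪T i) x∈Aᵢ)
  ...   | inj₁ x∈S = x∈p∪q⁺ (inj₁ (x∈⋃⁺ S i x∈S))
  ...   | inj₂ x∈T = x∈p∪q⁺ (inj₂ (x∈⋃⁺ T i x∈T))
  from : ⋃ (tabulate S) ∪ ⋃ (tabulate T) ⊆ ⋃ (tabulate A)
  from x∈ with x∈p∪q⁻ (⋃ (tabulate S)) _ x∈
  ... | inj₁ x∈⋃S = let i , x∈S = x∈⋃⁻ S x∈⋃S in
    x∈⋃⁺ A i (subst (_ ∈_) (sym (A≡S∪T i)) (x∈p∪q⁺ (inj₁ x∈S)))
  ... | inj₂ x∈⋃T = let i , x∈T = x∈⋃⁻ T x∈⋃T in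
    x∈⋃⁺ A i (subst (_ ∈_) (sym (A≡S∪T i)) (x∈p∪q⁺ (inj₂ x∈T)))

∣⋃∣≤sum : (S : Vector (Subset n) r) → ∣ ⋃ (tabulate S) ∣ ≤ sum (tabulate (∣_∣ ∘ S))
∣⋃∣≤sum {n} {zero}  S = ≤-reflexive (∣⊥∣≡0 n)
∣⋃∣≤sum {n} {suc r} S =
  ≤-trans (∣p∪q∣≤∣p∣+∣q∣ (S zero) _) (+-monoʳ-≤ ∣ S zero ∣ (∣⋃∣≤sum (S ∘ suc)))

disjoint⇒∣⋃∣≡sum : (S : Vector (Subset n) r) → (∀ i j → i ≢ j → Disjoint (S i) (S j)) →
  ∣ ⋃ (tabulate S) ∣ ≡ sum (tabulate (∣_∣ ∘ S))
disjoint⇒∣⋃∣≡sum {n} {zero}  S S∩S = ∣⊥∣≡0 n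
disjoint⇒∣⋃∣≡sum {n} {suc r} S S∩S =
  trans (Disjoint⇒∣p∪q∣≡∣p∣+∣q∣ (S zero) _ S₀∩⋃)
    (cong (∣ S zero ∣ +_)
      (disjoint⇒∣⋃∣≡sum (S ∘ suc) λ i j i≢j → S∩S (suc i) (suc j) λ { refl → i≢j refl }))
  where
  S₀∩⋃ : Disjoint (S zero) (⋃ (tabulate (S ∘ suc)))
  S₀∩⋃ (x , x∈) =
    let x∈S₀ , x∈⋃ = x∈p∩q⁻ (S zero) _ x∈
        i , x∈Sᵢ   = x∈⋃⁻ (S ∘ suc) x∈⋃
    in S∩S zero (suc i) (λ ()) (x , x∈p∩q⁺ (x∈S₀ , x∈Sᵢ))

-- Distances and coverage of tuples related by `≤D`

module _ {A J : Vector (Subset n) r} (A≤J : A ≤D J) where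
  open _≤D_ A≤J
  open _≡_⊎_ using (union; disjoint)

  B⊆A : ∀ i → B i ⊆ A i
  B⊆A i x∈B = subst (_ ∈_) (sym (union (A≡B⊎C i))) (p⊆p∪q (C i) x∈B)

  -- A common element cannot come from `L i`, which misses `L j` and also `K j`, a subset of `B j`;
  -- symmetrically for `L j`. So it lies in both `K i` and `K j`, and `K ⊆ B ⊆ A`.
  J∩J⊆A∩A : ∀ i j → i ≢ j → J i ∩ J j ⊆ A i ∩ A j
  J∩J⊆A∩A i j i≢j {x} x∈ with x∈p∩q⁻ (J i) (J j) x∈
  ... | x∈Jᵢ , x∈Jⱼ
      with x∈p∪q⁻ (K i) (L i) (subst (x ∈_) (union (J≡K⊎L i)) x∈Jᵢ)
         | x∈p∪q⁻ (K j) (L j) (subst (x ∈_) (union (J≡K⊎L j)) x∈Jⱼ)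
  ... | inj₁ x∈Kᵢ | inj₁ x∈Kⱼ = x∈p∩q⁺ (B⊆A i (K⊆B i x∈Kᵢ) , B⊆A j (K⊆B j x∈Kⱼ))
  ... | inj₁ x∈Kᵢ | inj₂ x∈Lⱼ = contradiction (x , x∈p∩q⁺ (x∈Lⱼ , K⊆B i x∈Kᵢ)) (L∩B j i)
  ... | inj₂ x∈Lᵢ | inj₁ x∈Kⱼ = contradiction (x , x∈p∩q⁺ (x∈Lᵢ , K⊆B j x∈Kⱼ)) (L∩B i j)
  ... | inj₂ x∈Lᵢ | inj₂ x∈Lⱼ = contradiction (x , x∈p∩q⁺ (x∈Lᵢ , x∈Lⱼ)) (L∩L i j i≢j)

  ∣A△A∣≤∣J△J∣ : ∀ i j → ∣ A i △ A j ∣ ≤ ∣ J i △ J j ∣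
  ∣A△A∣≤∣J△J∣ i j with i ≟ j
  -- The disjointness of `L i` and `L j` needs distinct indices. Treating equal ones too lets the
  -- lists over `pairs r` be compared entry by entry, without recording that `i < j`.
  ... | yes refl = ≤-trans (≤-reflexive (∣p△p∣≡0 (A i))) z≤n
    where
    ∣p△p∣≡0 : ∀ {m} (p : Subset m) → ∣ p △ p ∣ ≡ 0
    ∣p△p∣≡0 []            = refl
    ∣p△p∣≡0 (outside ∷ p) = ∣p△p∣≡0 p
    ∣p△p∣≡0 (inside  ∷ p) = ∣p△p∣≡0 p
  ... | no i≢j = +-cancelʳ-≤ (a + a) _ _ (begin
    ∣ A i △ A j ∣ + (a + a)   ≡⟨ ∣p△q∣+2∣p∩q∣≡∣p∣+∣q∣ (A i) (A j) ⟩
    ∣ A i ∣ + ∣ A j ∣         ≡⟨ cong₂ _+_ (∣A∣≡∣J∣ i) (∣A∣≡∣J∣ j) ⟩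
    ∣ J i ∣ + ∣ J j ∣         ≡⟨ ∣p△q∣+2∣p∩q∣≡∣p∣+∣q∣ (J i) (J j) ⟨
    ∣ J i △ J j ∣ + (b + b)   ≤⟨ +-monoʳ-≤ ∣ J i △ J j ∣ (+-mono-≤ b≤a b≤a) ⟩
    ∣ J i △ J j ∣ + (a + a)   ∎)
    where
    open ≤-Reasoning
    a b : ℕ
    a = ∣ A i ∩ A j ∣
    b = ∣ J i ∩ J j ∣
    b≤a : b ≤ a
    b≤a = p⊆q⇒∣p∣≤∣q∣ (J∩J⊆A∩A i j i≢j)

  -- `K i` lies in both `A i` and `J i`; as these have the same size, so do the remainders.
  ∣A─K∣≡∣L∣ : ∀ i → ∣ A i ─ K i ∣ ≡ ∣ L i ∣
  ∣A─K∣≡∣L∣ i = +-cancelˡ-≡ ∣ K i ∣ _ _ (begin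
    ∣ K i ∣ + ∣ A i ─ K i ∣   ≡⟨ Disjoint⇒∣p∪q∣≡∣p∣+∣q∣ (K i) (A i ─ K i) K∩[A─K] ⟨
    ∣ K i ∪ (A i ─ K i) ∣     ≡⟨ cong ∣_∣ (q⊆p⇒p≡q∪[p─q] (A i) (K i) (B⊆A i ∘ K⊆B i)) ⟨
    ∣ A i ∣                   ≡⟨ ∣A∣≡∣J∣ i ⟩
    ∣ J i ∣                   ≡⟨ cong ∣_∣ (union (J≡K⊎L i)) ⟩
    ∣ K i ∪ L i ∣             ≡⟨ Disjoint⇒∣p∪q∣≡∣p∣+∣q∣ (K i) (L i) (disjoint (J≡K⊎L i)) ⟩
    ∣ K i ∣ + ∣ L i ∣         ∎)
    where
    open ≡-Reasoning
    K∩[A─K] : Disjoint (K i) (A i ─ K i)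
    K∩[A─K] (x , x∈) =
      let x∈K , x∈A─K = x∈p∩q⁻ (K i) _ x∈ in x∈p─q⇒x∉q (A i) (K i) x∈A─K x∈K

  -- The differences `A i ─ K i` may overlap one another and the `K j`, so their sizes bound the
  -- coverage of `A` only from above. Each `L i` is disjoint from the other `L j` and from every
  -- `K j`, so the same sizes give the coverage of `J` exactly.
  ∣⋃A∣≤∣⋃J∣ : ∣ ⋃ (tabulate A) ∣ ≤ ∣ ⋃ (tabulate J) ∣
  ∣⋃A∣≤∣⋃J∣ = begin
    ∣ ⋃ (tabulate A) ∣
      ≡⟨ cong ∣_∣ (⋃-∪ A K D λ i → q⊆p⇒p≡q∪[p─q] (A i) (K i) (B⊆A i ∘ K⊆B i)) ⟩
    ∣ ⋃ (tabulate K) ∪ ⋃ (tabulate D) ∣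
      ≤⟨ ∣p∪q∣≤∣p∣+∣q∣ (⋃ (tabulate K)) _ ⟩
    ∣ ⋃ (tabulate K) ∣ + ∣ ⋃ (tabulate D) ∣
      ≤⟨ +-monoʳ-≤ ∣ ⋃ (tabulate K) ∣ (∣⋃∣≤sum D) ⟩
    ∣ ⋃ (tabulate K) ∣ + sum (tabulate (∣_∣ ∘ D))
      ≡⟨ cong (λ l → ∣ ⋃ (tabulate K) ∣ + sum l) (tabulate-cong ∣A─K∣≡∣L∣) ⟩
    ∣ ⋃ (tabulate K) ∣ + sum (tabulate (∣_∣ ∘ L))
      ≡⟨ cong (∣ ⋃ (tabulate K) ∣ +_) (disjoint⇒∣⋃∣≡sum L L∩L) ⟨
    ∣ ⋃ (tabulate K) ∣ + ∣ ⋃ (tabulate L) ∣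
      ≡⟨ Disjoint⇒∣p∪q∣≡∣p∣+∣q∣ (⋃ (tabulate K)) _ ⋃K∩⋃L ⟨
    ∣ ⋃ (tabulate K) ∪ ⋃ (tabulate L) ∣
      ≡⟨ cong ∣_∣ (⋃-∪ J K L (union ∘ J≡K⊎L)) ⟨
    ∣ ⋃ (tabulate J) ∣ ∎
    where
    open ≤-Reasoning
    D : Vector (Subset n) r
    D i = A i ─ K i
    ⋃K∩⋃L : Disjoint (⋃ (tabulate K)) (⋃ (tabulate L))
    ⋃K∩⋃L (x , x∈) =
      let x∈⋃K , x∈⋃L = x∈p∩q⁻ (⋃ (tabulate K)) _ x∈
          i , x∈K     = x∈⋃⁻ K x∈⋃K
          j , x∈L     = x∈⋃⁻ L x∈⋃L
      in L∩B j i (x , x∈p∩q⁺ (x∈L , K⊆B i x∈K))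

-- Consistent diversity of the three measures

module _ {X : Set} {f g : X → ℕ} (f≤g : ∀ x → f x ≤ g x) where

  sum-map-mono-≤ : ∀ xs → sum (map f xs) ≤ sum (map g xs)
  sum-map-mono-≤ []       = z≤n
  sum-map-mono-≤ (x ∷ xs) = +-mono-≤ (f≤g x) (sum-map-mono-≤ xs)

  minimum-map-mono-≤ : ∀ xs → minimum (map f xs) ≤ minimum (map g xs)
  minimum-map-mono-≤ []       = z≤n
  minimum-map-mono-≤ (x ∷ xs) = go xs
    where
    go : ∀ ys → foldr _⊓_ (f x) (map f ys) ≤ foldr _⊓_ (g x) (map g ys)
    go []       = f≤g x
    go (y ∷ ys) = ⊓-mono-≤ (f≤g y) (go ys)

d-sum-consistentlyDiverse : ∀ r → ConsistentlyDiverse (d-sum r)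
d-sum-consistentlyDiverse r A J A≤J =
  sum-map-mono-≤ (λ (i , j) → ∣A△A∣≤∣J△J∣ A≤J i j) (pairs r)

d-min-consistentlyDiverse : ∀ r → ConsistentlyDiverse (d-min r)
d-min-consistentlyDiverse r A J A≤J =
  minimum-map-mono-≤ (λ (i , j) → ∣A△A∣≤∣J△J∣ A≤J i j) (pairs r)

d-cov-consistentlyDiverse : ∀ r → ConsistentlyDiverse (d-cov r)
d-cov-consistentlyDiverse r A J A≤J
  -- `allFin r` is `tabulate` of the identity, so both unions become unions over `tabulate`.
  rewrite map-tabulate (λ i → i) A | map-tabulate (λ i → i) J = ∣⋃A∣≤∣⋃J∣ A≤J

-- Expressions and their compilation

-- index stands for the variable bound by the innermost Σ, and Σ e for the sum of e over
-- index = 0, …, n − 1, where n is the content of memory cell 0.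
infixl 6 _⊕_ _⊖_

data Expr : Set where
  lit     : ℕ → Expr
  index   : Expr
  cell    : Expr → Expr
  _⊕_ _⊖_ : Expr → Expr → Expr
  Σ       : Expr → Expr

eval : (ℕ → ℕ) → ℕ → Expr → ℕ
eval M i (lit c)   = c
eval M i index     = i
eval M i (cell e)  = M (eval M i e)
eval M i (e₁ ⊕ e₂) = eval M i e₁ + eval M i e₂
eval M i (e₁ ⊖ e₂) = eval M i e₁ ∸ eval M i e₂
-- The terms are listed in the order in which a loop counting down adds them.
eval M i (Σ e)     = sum (applyDownFrom (λ j → eval M j e) (M 0))

-- compile p x e leaves the value of e in register x and keeps its temporaries above x;
-- index is read from register p < x.
compile : Reg → Reg → Expr → Program
loop    : Reg → Expr → Program

compile p x (lit c)   = instr (const x c)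
-- A copy is made by clearing `x` and adding `p`; since `p < x`, the clearing leaves `p` intact.
compile p x index     = instr (const x 0) ⨾ instr (add x x p)
compile p x (cell e)  = compile p x e ⨾ instr (load x x)
compile p x (e₁ ⊕ e₂) = compile p x e₁ ⨾ compile p (suc x) e₂ ⨾ instr (add x x (suc x))
compile p x (e₁ ⊖ e₂) = compile p x e₁ ⨾ compile p (suc x) e₂ ⨾ instr (sub x x (suc x))
compile p x (Σ e)     =
  instr (const x 0) ⨾ instr (const (1 + x) 0) ⨾ instr (load (1 + x) (1 + x)) ⨾ loop x e

-- Register `x` accumulates the sum and `1 + x` counts down. The counter is decremented before the
-- body, so it runs through n - 1, ..., 0 there and doubles as the index. Register `2 + x` holds
-- first the constant 1, then the summand.
loop x e = while (1 + x)
  ( instr (const (2 + x) 1) ⨾ instr (sub (1 + x) (1 + x) (2 + x))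
  ⨾ compile (1 + x) (2 + x) e ⨾ instr (add x x (2 + x)))

-- The running time is exact and independent of the data: compiled code has no `ifnz`, and every
-- loop makes exactly `n` passes.
time     : ℕ → Expr → ℕ
loopTime : ℕ → ℕ → ℕ

time n (lit c)   = 1
time n index     = 2
time n (cell e)  = time n e + 1
time n (e₁ ⊕ e₂) = time n e₁ + (time n e₂ + 1)
time n (e₁ ⊖ e₂) = time n e₁ + (time n e₂ + 1)
time n (Σ e)     = 3 + loopTime (time n e) n

loopTime t zero    = 1
loopTime t (suc m) = suc (2 + (t + 1) + loopTime t m)

-- Correctness and exact running time of compiled programs

[≔]-hit : ∀ f a v → (f [ a ≔ v ]) a ≡ v
[≔]-hit f zero    v = refl
[≔]-hit f (suc a) v = [≔]-hit (f ∘ suc) a v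

[≔]-miss : ∀ f {a b} v → a ≢ b → (f [ a ≔ v ]) b ≡ f b
[≔]-miss f {zero}  {zero}  v a≢b = contradiction refl a≢b
[≔]-miss f {zero}  {suc b} v a≢b = refl
[≔]-miss f {suc a} {zero}  v a≢b = refl
[≔]-miss f {suc a} {suc b} v a≢b = [≔]-miss (f ∘ suc) v (a≢b ∘ cong suc)

-- `frame` protects the index register and the pending results of enclosing expressions, all of
-- which lie below `x`. `memory` ensures that later subexpressions read the original input.
record Runs (s : State) (P : Program) (x : Reg) (v t : ℕ) : Set where
  field
    final   : State
    run     : s ⊢ P ⇓ final in-time t
    value   : reg final x ≡ v
    frame   : ∀ {y} → y < x → reg final y ≡ reg s y
    memory  : mem final ≡ mem s

open Runs

-- The first operand survives in `x` because the second program only disturbs registers from `suc x`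
-- on.
runs-binary : ∀ (_∙_ : ℕ → ℕ → ℕ) (I : Instr) {s P Q x v w t u} →
  (∀ s′ → exec I s′ ≡ ⟪ reg s′ [ x ≔ reg s′ x ∙ reg s′ (suc x) ] , mem s′ ⟫) →
  (α : Runs s P x v t) → Runs (final α) Q (suc x) w u →
  Runs s (P ⨾ Q ⨾ instr I) x (v ∙ w) (t + (u + 1))
runs-binary _∙_ I {x = x} I≡ α β = record
  { final  = exec I (final β)
  ; run    = seq (run α) (seq (run β) (instr I))
  ; value  = trans (cong (λ s → reg s x) (I≡ (final β))) (trans ([≔]-hit (reg (final β)) x _)
               (cong₂ _∙_ (trans (frame β (n<1+n x)) (value α)) (value β)))
  ; frame  = λ {y} y<x → trans (cong (λ s → reg s y) (I≡ (final β)))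
               (trans ([≔]-miss (reg (final β)) _ (>⇒≢ y<x))
                 (trans (frame β (m<n⇒m<1+n y<x)) (frame α y<x)))
  ; memory = trans (cong mem (I≡ (final β))) (trans (memory β) (memory α))
  }

compile-correct : ∀ e s {p x} → p < x →
  Runs s (compile p x e) x (eval (mem s) (reg s p) e) (time (mem s 0) e)
-- The loop invariant: the accumulator plus the terms still to come is constant. The accumulator and
-- the counter value `m` are arbitrary, so that induction on `m` goes through.
loop-correct : ∀ e s x m → reg s (1 + x) ≡ m →
  Runs s (loop x e) x (reg s x + sum (applyDownFrom (λ j → eval (mem s) j e) m))
    (loopTime (time (mem s 0) e) m)

compile-correct (lit c) s {x = x} p<x = record
  { run    = instr (const x c)
  ; value  = [≔]-hit (reg s) x c
  ; frame  = λ y<x → [≔]-miss (reg s) c (>⇒≢ y<x)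
  ; memory = refl
  }
compile-correct index s {p} {x} p<x = record
  { run    = seq (instr (const x 0)) (instr (add x x p))
  ; value  = trans ([≔]-hit (reg s [ x ≔ 0 ]) x _)
               (cong₂ _+_ ([≔]-hit (reg s) x 0) ([≔]-miss (reg s) 0 (>⇒≢ p<x)))
  ; frame  = λ y<x →
      trans ([≔]-miss (reg s [ x ≔ 0 ]) _ (>⇒≢ y<x)) ([≔]-miss (reg s) 0 (>⇒≢ y<x))
  ; memory = refl
  }
compile-correct (cell e) s {p} {x} p<x = record
  { run    = seq (run α) (instr (load x x))
  ; value  = trans ([≔]-hit (reg (final α)) x _) (cong₂ (λ M a → M a) (memory α) (value α))
  ; frame  = λ y<x → trans ([≔]-miss (reg (final α)) _ (>⇒≢ y<x)) (frame α y<x)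
  ; memory = memory α
  }
  where
  α : Runs s (compile p x e) x (eval (mem s) (reg s p) e) (time (mem s 0) e)
  α = compile-correct e s p<x
compile-correct (e₁ ⊕ e₂) s {p} {x} p<x = runs-binary _+_ _ (λ _ → refl) α β
  where
  α : Runs s (compile p x e₁) x (eval (mem s) (reg s p) e₁) (time (mem s 0) e₁)
  α = compile-correct e₁ s p<x
  β : Runs (final α) (compile p (suc x) e₂) (suc x)
        (eval (mem s) (reg s p) e₂) (time (mem s 0) e₂)
  -- `α` changes neither the memory nor register `p`, so `e₂` has the same value and running time
  -- after it.
  β rewrite sym (memory α) | sym (frame α p<x) =
    compile-correct e₂ (final α) (m<n⇒m<1+n p<x)
compile-correct (e₁ ⊖ e₂) s {p} {x} p<x = runs-binary _∸_ _ (λ _ → refl) α β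
  where
  α : Runs s (compile p x e₁) x (eval (mem s) (reg s p) e₁) (time (mem s 0) e₁)
  α = compile-correct e₁ s p<x
  β : Runs (final α) (compile p (suc x) e₂) (suc x)
        (eval (mem s) (reg s p) e₂) (time (mem s 0) e₂)
  β rewrite sym (memory α) | sym (frame α p<x) =
    compile-correct e₂ (final α) (m<n⇒m<1+n p<x)
compile-correct (Σ e) s {p} {x} p<x = record
  { run    = seq (instr _) (seq (instr _) (seq (instr _) (run looping)))
  ; value  = trans (value looping)
               (cong (_+ sum (applyDownFrom (λ j → eval (mem s) j e) (mem s 0))) 0≡)
  ; frame  = λ {y} y<x → trans (frame looping y<x)
               (trans ([≔]-miss R₂ _ (>⇒≢ (m<n⇒m<1+n y<x)))
                 (trans ([≔]-miss R₁ 0 (>⇒≢ (m<n⇒m<1+n y<x))) ([≔]-miss (reg s) 0 (>⇒≢ y<x))))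
  ; memory = memory looping
  }
  where
  R₁ R₂ R₃ : ℕ → ℕ
  R₁ = reg s [ x ≔ 0 ]
  R₂ = R₁ [ 1 + x ≔ 0 ]
  R₃ = R₂ [ 1 + x ≔ mem s (R₂ (1 + x)) ]
  0≡ : R₃ x ≡ 0
  0≡ = trans ([≔]-miss R₂ _ (>⇒≢ (n<1+n x)))
         (trans ([≔]-miss R₁ 0 (>⇒≢ (n<1+n x))) ([≔]-hit (reg s) x 0))
  looping : Runs ⟪ R₃ , mem s ⟫ (loop x e) x
         (R₃ x + sum (applyDownFrom (λ j → eval (mem s) j e) (mem s 0)))
         (loopTime (time (mem s 0) e) (mem s 0))
  looping = loop-correct e ⟪ R₃ , mem s ⟫ x (mem s 0)
         (trans ([≔]-hit R₂ (1 + x) _) (cong (mem s) ([≔]-hit R₁ (1 + x) 0)))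

loop-correct e s x zero c≡0 = record
  { run    = while-stop c≡0
  ; value  = sym (+-identityʳ _)
  ; frame  = λ _ → refl
  ; memory = refl
  }
loop-correct e s x (suc m) c≡1+m = record
  { run    = while-step (λ c≡0 → 0≢1+n (trans (sym c≡0) c≡1+m))
               (seq (instr _) (seq (instr _) (seq (run β) (instr _)))) (run γ)
  ; value  = trans (value γ) (trans (cong (_+ rest) x≡) (+-assoc (reg s x) (eval (mem s) m e) rest))
  ; frame  = λ {y} y<x → trans (frame γ y<x)
               (trans ([≔]-miss (reg (final β)) _ (>⇒≢ y<x)) (below (m<n⇒m<1+n y<x)))
  ; memory = trans (memory γ) (memory β)
  }
  where
  rest : ℕ
  rest = sum (applyDownFrom (λ j → eval (mem s) j e) m)
  R₁ R₂ : ℕ → ℕ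
  R₁ = reg s [ 2 + x ≔ 1 ]
  R₂ = R₁ [ 1 + x ≔ R₁ (1 + x) ∸ R₁ (2 + x) ]
  c≡m : R₂ (1 + x) ≡ m
  c≡m = trans ([≔]-hit R₁ (1 + x) _)
          (cong₂ _∸_ (trans ([≔]-miss (reg s) 1 (>⇒≢ (n<1+n (1 + x)))) c≡1+m)
                     ([≔]-hit (reg s) (2 + x) 1))
  β : Runs ⟪ R₂ , mem s ⟫ (compile (1 + x) (2 + x) e) (2 + x)
        (eval (mem s) m e) (time (mem s 0) e)
  -- The body takes its index from the decremented counter, so this pass contributes the term at
  -- `m`.
  β = subst (λ i → Runs ⟪ R₂ , mem s ⟫ (compile (1 + x) (2 + x) e) (2 + x)
              (eval (mem s) i e) (time (mem s 0) e))
        c≡m (compile-correct e ⟪ R₂ , mem s ⟫ (n<1+n (1 + x)))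
  below : ∀ {y} → y < 1 + x → reg (final β) y ≡ reg s y
  below y<1+x = trans (frame β (m<n⇒m<1+n y<1+x))
    (trans ([≔]-miss R₁ _ (>⇒≢ y<1+x)) ([≔]-miss (reg s) 1 (>⇒≢ (m<n⇒m<1+n y<1+x))))
  next : State
  next = exec (add x x (2 + x)) (final β)
  x≡ : reg next x ≡ reg s x + eval (mem s) m e
  x≡ = trans ([≔]-hit (reg (final β)) x _) (cong₂ _+_ (below (n<1+n x)) (value β))
  γ : Runs next (loop x e) x (reg next x + rest) (loopTime (time (mem s 0) e) m)
  γ = subst (λ M → Runs next (loop x e) x
              (reg next x + sum (applyDownFrom (λ j → eval M j e) m)) (loopTime (time (M 0) e) m))
        (memory β)
        (loop-correct e next x m (trans ([≔]-miss (reg (final β)) _ (<⇒≢ (n<1+n x)))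
          (trans (frame β (n<1+n (1 + x))) c≡m)))

-- Polynomial bounds on running times

-- Powers of 1 + n rather than n, so that the bounds stay monotone in k at n = 0.
PolynomiallyBounded : (ℕ → ℕ) → Set
PolynomiallyBounded f = ∃[ c ] ∃[ k ] ∀ n → f n ≤ c * suc n ^ k

const-bounded : ∀ a → PolynomiallyBounded (λ _ → a)
const-bounded a = a , 0 , λ n → ≤-reflexive (sym (*-identityʳ a))

+-bounded : ∀ {f g} → PolynomiallyBounded f → PolynomiallyBounded g →
  PolynomiallyBounded (λ n → f n + g n)
+-bounded {f} {g} (c , k , f≤) (d , l , g≤) = c + d , k + l , λ n → begin
  f n + g n                                     ≤⟨ +-mono-≤ (f≤ n) (g≤ n) ⟩
  c * suc n ^ k + d * suc n ^ l                 ≤⟨ +-mono-≤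
    (*-monoʳ-≤ c (^-monoʳ-≤ (suc n) (m≤m+n k l)))
    (*-monoʳ-≤ d (^-monoʳ-≤ (suc n) (m≤n+m l k))) ⟩
  c * suc n ^ (k + l) + d * suc n ^ (k + l)     ≡⟨ *-distribʳ-+ (suc n ^ (k + l)) c d ⟨
  (c + d) * suc n ^ (k + l)                     ∎
  where open ≤-Reasoning

n*-bounded : ∀ {f} → PolynomiallyBounded f → PolynomiallyBounded (λ n → n * f n)
n*-bounded {f} (c , k , f≤) = c , suc k , λ n → begin
  n * f n                     ≤⟨ *-mono-≤ (n≤1+n n) (f≤ n) ⟩
  suc n * (c * suc n ^ k)     ≡⟨ swap (suc n) c (suc n ^ k) ⟩
  c * (suc n * suc n ^ k)     ∎
  where
  open ≤-Reasoning
  swap : ∀ a b d → a * (b * d) ≡ b * (a * d)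
  swap = solve-∀

-- A pass costs `4 + t`: the test, three single instructions and the body. The final 1 is the
-- failing test.
loopTime≡ : ∀ t m → loopTime t m ≡ m * (4 + t) + 1
loopTime≡ t zero    = refl
loopTime≡ t (suc m) = trans (cong (λ l → suc (2 + (t + 1) + l)) (loopTime≡ t m)) (step t m)
  where
  step : ∀ t m → suc (2 + (t + 1) + (m * (4 + t) + 1)) ≡ 4 + t + m * (4 + t) + 1
  step = solve-∀

time-bounded : ∀ e → PolynomiallyBounded (λ n → time n e)
time-bounded (lit c)   = const-bounded 1
time-bounded index     = const-bounded 2
time-bounded (cell e)  = +-bounded (time-bounded e) (const-bounded 1)
time-bounded (e₁ ⊕ e₂) =
  +-bounded (time-bounded e₁) (+-bounded (time-bounded e₂) (const-bounded 1))
time-bounded (e₁ ⊖ e₂) =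
  +-bounded (time-bounded e₁) (+-bounded (time-bounded e₂) (const-bounded 1))
time-bounded (Σ e) =
  let c , k , ≤ck = +-bounded (const-bounded 3)
        (+-bounded (n*-bounded (+-bounded (const-bounded 4) (time-bounded e))) (const-bounded 1))
  in c , k , λ n → ≤-trans (≤-reflexive (cong (3 +_) (loopTime≡ (time n e) n))) (≤ck n)

[m*n]^k≡m^k*n^k : ∀ m n k → (m * n) ^ k ≡ m ^ k * n ^ k
[m*n]^k≡m^k*n^k m n zero    = refl
[m*n]^k≡m^k*n^k m n (suc k) =
  trans (cong (m * n *_) ([m*n]^k≡m^k*n^k m n k)) (interchange m n (m ^ k) (n ^ k))
  where
  interchange : ∀ a b c d → a * b * (c * d) ≡ a * c * (b * d)
  interchange = solve-∀

-- Converts powers of 1 + n into the required form. For n ≥ 1 use 1 + n ≤ 2n; at n = 0 the additive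
-- constant suffices.
[1+n]^k≤2^k*n^k+2^k : ∀ n k → suc n ^ k ≤ 2 ^ k * n ^ k + 2 ^ k
[1+n]^k≤2^k*n^k+2^k zero    k = begin
  1 ^ k                     ≤⟨ ^-monoˡ-≤ k (s≤s z≤n) ⟩
  2 ^ k                     ≤⟨ m≤n+m (2 ^ k) (2 ^ k * 0 ^ k) ⟩
  2 ^ k * 0 ^ k + 2 ^ k     ∎
  where open ≤-Reasoning
[1+n]^k≤2^k*n^k+2^k n@(suc m) k = begin
  suc n ^ k                 ≤⟨ ^-monoˡ-≤ k (s≤s (≤-trans (m≤n+m n m) (+-monoʳ-≤ m (m≤m+n n 0)))) ⟩
  (2 * n) ^ k               ≡⟨ [m*n]^k≡m^k*n^k 2 n k ⟩
  2 ^ k * n ^ k             ≤⟨ m≤m+n _ _ ⟩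
  2 ^ k * n ^ k + 2 ^ k     ∎
  where open ≤-Reasoning

expressible⇒polynomialTimeComputable : ∀ {𝔻 : Diversity r} e →
  (∀ n S → eval (at (encode S)) 0 e ≡ 𝔻 n S) → PolynomialTimeComputable 𝔻
expressible⇒polynomialTimeComputable {r} {𝔻} e e≡𝔻 =
  let c , k , t≤ = +-bounded (time-bounded e) (const-bounded 1)
      C = c * 2 ^ k
  -- Register 0 starts at 0 and serves as the index outside every `Σ`. By `frame` it is still 0 when
  -- the last instruction adds the result from register 1 to it.
  in compile 0 1 e ⨾ instr (add 0 0 1) , C , k , λ n S →
     let α = compile-correct e (initial (encode S)) (n<1+n 0)
     in _ , _ , seq (run α) (instr (add 0 0 1))
      , trans (cong₂ _+_ (frame α (n<1+n 0)) (value α)) (e≡𝔻 n S)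
      , (begin
          time n e + 1                    ≤⟨ t≤ n ⟩
          c * suc n ^ k                   ≤⟨ *-monoʳ-≤ c ([1+n]^k≤2^k*n^k+2^k n k) ⟩
          c * (2 ^ k * n ^ k + 2 ^ k)     ≡⟨ expand c (2 ^ k) (n ^ k) ⟩
          C * n ^ k + C                   ∎)
  where
  open ≤-Reasoning
  expand : ∀ a b d → a * (b * d + b) ≡ a * b * d + a * b
  expand = solve-∀

-- Characteristic functions and their layout in memory

-- The default 0 of `at` extends the characteristic vector to all of ℕ, so the identities below need
-- no range condition.
χ : Subset n → ℕ → ℕ
χ S = at (map bit (toList S))

χ-⊥ : ∀ n x → χ (⊥ {n}) x ≡ 0
χ-⊥ zero    x       = refl
χ-⊥ (suc n) zero    = refl
χ-⊥ (suc n) (suc x) = χ-⊥ n x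

χ-∪ : ∀ (S T : Subset n) x → χ (S ∪ T) x ≡ χ S x ⊔ χ T x
χ-∪ []            []            x       = refl
χ-∪ (outside ∷ S) (outside ∷ T) zero    = refl
χ-∪ (outside ∷ S) (inside  ∷ T) zero    = refl
χ-∪ (inside  ∷ S) (outside ∷ T) zero    = refl
χ-∪ (inside  ∷ S) (inside  ∷ T) zero    = refl
χ-∪ (_       ∷ S) (_       ∷ T) (suc x) = χ-∪ S T x

χ-△ : ∀ (S T : Subset n) x → χ (S △ T) x ≡ (χ S x ∸ χ T x) + (χ T x ∸ χ S x)
χ-△ []            []            x       = refl
χ-△ (outside ∷ S) (outside ∷ T) zero    = refl
χ-△ (outside ∷ S) (inside  ∷ T) zero    = refl
χ-△ (inside  ∷ S) (outside ∷ T) zero    = refl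
χ-△ (inside  ∷ S) (inside  ∷ T) zero    = refl
χ-△ (_       ∷ S) (_       ∷ T) (suc x) = χ-△ S T x

χ-⋃ : ∀ (Ss : List (Subset n)) x → χ (⋃ Ss) x ≡ foldr _⊔_ 0 (map (λ S → χ S x) Ss)
χ-⋃ {n} []       x = χ-⊥ n x
χ-⋃     (S ∷ Ss) x = trans (χ-∪ S (⋃ Ss) x) (cong (χ S x ⊔_) (χ-⋃ Ss x))

-- `applyDownFrom` peels off the last term, whereas induction on a subset peels off position 0.
sum-applyDownFrom-suc : ∀ f n →
  sum (applyDownFrom f (suc n)) ≡ f 0 + sum (applyDownFrom (f ∘ suc) n)
sum-applyDownFrom-suc f zero    = refl
sum-applyDownFrom-suc f (suc n) =
  trans (cong (f (suc n) +_) (sum-applyDownFrom-suc f n))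
    (exchange (f (suc n)) (f 0) (sum (applyDownFrom (f ∘ suc) n)))
  where
  exchange : ∀ a b d → a + (b + d) ≡ b + (a + d)
  exchange = solve-∀

∣S∣≡sum-χ : (S : Subset n) → ∣ S ∣ ≡ sum (applyDownFrom (χ S) n)
∣S∣≡sum-χ []                    = refl
∣S∣≡sum-χ {suc n} (outside ∷ S) =
  trans (∣S∣≡sum-χ S) (sym (sum-applyDownFrom-suc (χ (outside ∷ S)) n))
∣S∣≡sum-χ {suc n} (inside ∷ S)  =
  trans (cong suc (∣S∣≡sum-χ S)) (sym (sum-applyDownFrom-suc (χ (inside ∷ S)) n))

-- Agreement is asked only below `n`: reading past the block of one set in memory runs into the
-- next.
sum-applyDownFrom-cong : ∀ {f g} n → (∀ x → x < n → f x ≡ g x) →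
  sum (applyDownFrom f n) ≡ sum (applyDownFrom g n)
sum-applyDownFrom-cong zero    f≡g = refl
sum-applyDownFrom-cong (suc n) f≡g = cong₂ _+_ (f≡g n (n<1+n n))
  (sum-applyDownFrom-cong n λ x x<n → f≡g x (m<n⇒m<1+n x<n))

at-++ˡ : ∀ (S : Subset n) ys {x} → x < n → at (map bit (toList S) ++ ys) x ≡ χ S x
at-++ˡ (b ∷ S) ys {zero}  _         = refl
at-++ˡ (b ∷ S) ys {suc x} (s≤s x<n) = at-++ˡ S ys x<n

at-++ʳ : ∀ (S : Subset n) ys x → at (map bit (toList S) ++ ys) (n + x) ≡ at ys x
at-++ʳ []      ys x = refl
at-++ʳ (b ∷ S) ys x = at-++ʳ S ys x

-- Block `i` starts at offset i · n. The map `f` generalises the identity behind `allFin r`, since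
-- the induction replaces it by `f ∘ suc`.
at-concatMap : ∀ {m} (S : Vector (Subset n) r) (f : Fin m → Fin r) i {x} → x < n →
  at (concatMap (λ j → map bit (toList (S j))) (tabulate f)) (toℕ i * n + x) ≡ χ (S (f i)) x
at-concatMap     S f zero    x<n = at-++ˡ (S (f zero)) _ x<n
at-concatMap {n} S f (suc i) {x} x<n
  rewrite +-assoc n (toℕ i * n) x =
  trans (at-++ʳ (S (f zero)) _ (toℕ i * n + x)) (at-concatMap S (f ∘ suc) i x<n)

-- Expressions for the three measures

-- Repeated addition replaces the missing multiplication. The factor will be a set's index, so the
-- size of the expression does not depend on `n`.
scale : ℕ → Expr → Expr
scale zero    e = lit 0
scale (suc k) e = e ⊕ scale k e

eval-scale : ∀ M i k e → eval M i (scale k e) ≡ k * eval M i e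
eval-scale M i zero    e = refl
eval-scale M i (suc k) e = cong (eval M i e +_) (eval-scale M i k e)

-- Cell 0 holds n, so the bit of the i-th set at `index` is in cell 1 + i · n + `index`.
member : Fin r → Expr
member i = cell (lit 1 ⊕ (scale (toℕ i) (cell (lit 0)) ⊕ index))

eval-member : ∀ (S : Vector (Subset n) r) i x → x < n →
  eval (at (encode S)) x (member i) ≡ χ (S i) x
eval-member S i x x<n
  rewrite eval-scale (at (encode S)) x (toℕ i) (cell (lit 0)) = at-concatMap S (λ j → j) i x<n

distance : Fin r × Fin r → Expr
distance (i , j) = Σ ((member i ⊖ member j) ⊕ (member j ⊖ member i))

eval-distance : ∀ (S : Vector (Subset n) r) x ij →
  eval (at (encode S)) x (distance ij) ≡ ∣ S (proj₁ ij) △ S (proj₂ ij) ∣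
eval-distance {n} S _ (i , j) =
  trans (sum-applyDownFrom-cong n λ x x<n →
      trans (cong₂ (λ a b → (a ∸ b) + (b ∸ a)) (eval-member S i x x<n) (eval-member S j x x<n))
        (sym (χ-△ (S i) (S j) x)))
    (sym (∣S∣≡sum-χ (S i △ S j)))

-- Truncated subtraction yields minimum and maximum without branching.
_⊓ᴱ_ _⊔ᴱ_ : Expr → Expr → Expr
e₁ ⊓ᴱ e₂ = e₁ ⊖ (e₁ ⊖ e₂)
e₁ ⊔ᴱ e₂ = e₁ ⊕ (e₂ ⊖ e₁)

m∸[m∸n]≡m⊓n : ∀ m n → m ∸ (m ∸ n) ≡ m ⊓ n
m∸[m∸n]≡m⊓n zero    n       = 0∸n≡0 (zero ∸ n)
m∸[m∸n]≡m⊓n (suc m) zero    = n∸n≡0 m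
m∸[m∸n]≡m⊓n (suc m) (suc n) =
  trans (+-∸-assoc 1 (m∸n≤m m n)) (cong suc (m∸[m∸n]≡m⊓n m n))

m+[n∸m]≡m⊔n : ∀ m n → m + (n ∸ m) ≡ m ⊔ n
m+[n∸m]≡m⊔n zero    n       = refl
m+[n∸m]≡m⊔n (suc m) zero    = cong suc (+-identityʳ m)
m+[n∸m]≡m⊔n (suc m) (suc n) = cong suc (m+[n∸m]≡m⊔n m n)

module _ {M : ℕ → ℕ} {i : ℕ} where

  eval-foldr : ∀ {_∙ᴱ_ : Expr → Expr → Expr} {_∙_ : ℕ → ℕ → ℕ} →
    (∀ e₁ e₂ → eval M i (e₁ ∙ᴱ e₂) ≡ eval M i e₁ ∙ eval M i e₂) →
    ∀ e es → eval M i (foldr _∙ᴱ_ e es) ≡ foldr _∙_ (eval M i e) (map (eval M i) es)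
  eval-foldr         hom e []        = refl
  eval-foldr {_∙_ = _∙_} hom e (e′ ∷ es) =
    trans (hom e′ _) (cong (eval M i e′ ∙_) (eval-foldr hom e es))

  eval-⊓ᴱ : ∀ e₁ e₂ → eval M i (e₁ ⊓ᴱ e₂) ≡ eval M i e₁ ⊓ eval M i e₂
  eval-⊓ᴱ e₁ e₂ = m∸[m∸n]≡m⊓n (eval M i e₁) (eval M i e₂)

  eval-⊔ᴱ : ∀ e₁ e₂ → eval M i (e₁ ⊔ᴱ e₂) ≡ eval M i e₁ ⊔ eval M i e₂
  eval-⊔ᴱ e₁ e₂ = m+[n∸m]≡m⊔n (eval M i e₁) (eval M i e₂)

minimumᴱ : List Expr → Expr
minimumᴱ []       = lit 0
minimumᴱ (e ∷ es) = foldr _⊓ᴱ_ e es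

eval-minimumᴱ : ∀ M i es → eval M i (minimumᴱ es) ≡ minimum (map (eval M i) es)
eval-minimumᴱ M i []       = refl
eval-minimumᴱ M i (e ∷ es) = eval-foldr eval-⊓ᴱ e es

eval-distances : ∀ (S : Vector (Subset n) r) x →
  map (eval (at (encode S)) x) (map distance (pairs r)) ≡ distances S
eval-distances {r = r} S x =
  trans (sym (map-∘ (pairs r))) (map-cong (eval-distance S x) (pairs r))

-- Polynomial-time computability of the three measures

d-sum-polynomialTimeComputable : ∀ r → PolynomialTimeComputable (d-sum r)
d-sum-polynomialTimeComputable r =
  expressible⇒polynomialTimeComputable {𝔻 = d-sum r}
    (foldr _⊕_ (lit 0) (map distance (pairs r))) λ n S →
    trans (eval-foldr (λ _ _ → refl) (lit 0) (map distance (pairs r)))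
      (cong sum (eval-distances S 0))

d-min-polynomialTimeComputable : ∀ r → PolynomialTimeComputable (d-min r)
d-min-polynomialTimeComputable r =
  expressible⇒polynomialTimeComputable {𝔻 = d-min r}
    (minimumᴱ (map distance (pairs r))) λ n S →
    trans (eval-minimumᴱ _ 0 (map distance (pairs r))) (cong minimum (eval-distances S 0))

d-cov-polynomialTimeComputable : ∀ r → PolynomialTimeComputable (d-cov r)
d-cov-polynomialTimeComputable r =
  expressible⇒polynomialTimeComputable {𝔻 = d-cov r}
    -- The maximum of the r bits at a point is its bit in the union, so points covered several times
    -- count once.
    (Σ (foldr _⊔ᴱ_ (lit 0) (map member (allFin r)))) λ n S →
    trans (sum-applyDownFrom-cong n (covered S)) (sym (∣S∣≡sum-χ (⋃ (map S (allFin r)))))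
  where
  open ≡-Reasoning
  covered : ∀ {n} (S : Vector (Subset n) r) x → x < n →
    eval (at (encode S)) x (foldr _⊔ᴱ_ (lit 0) (map member (allFin r)))
      ≡ χ (⋃ (map S (allFin r))) x
  covered S x x<n = begin
    eval M x (foldr _⊔ᴱ_ (lit 0) (map member (allFin r)))
      ≡⟨ eval-foldr eval-⊔ᴱ (lit 0) (map member (allFin r)) ⟩
    foldr _⊔_ 0 (map (eval M x) (map member (allFin r)))
      ≡⟨ cong (foldr _⊔_ 0) (map-∘ (allFin r)) ⟨
    foldr _⊔_ 0 (map (λ i → eval M x (member i)) (allFin r))
      ≡⟨ cong (foldr _⊔_ 0) (map-cong (λ i → eval-member S i x x<n) (allFin r)) ⟩
    foldr _⊔_ 0 (map (λ i → χ (S i) x) (allFin r))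
      ≡⟨ cong (foldr _⊔_ 0) (map-∘ (allFin r)) ⟩
    foldr _⊔_ 0 (map (λ T → χ T x) (map S (allFin r)))
      ≡⟨ χ-⋃ (map S (allFin r)) x ⟨
    χ (⋃ (map S (allFin r))) x ∎
    where
    M : ℕ → ℕ
    M = at (encode S)

lemma9 : (r : ℕ) →
    (ConsistentlyDiverse (d-sum r) × PolynomialTimeComputable (d-sum r)) ×
    (ConsistentlyDiverse (d-min r) × PolynomialTimeComputable (d-min r)) ×
    (ConsistentlyDiverse (d-cov r) × PolynomialTimeComputable (d-cov r))
lemma9 r =
  (d-sum-consistentlyDiverse r , d-sum-polynomialTimeComputable r) ,
  (d-min-consistentlyDiverse r , d-min-polynomialTimeComputable r) ,
  (d-cov-consistentlyDiverse r , d-cov-polynomialTimeComputable r)
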